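{- For all integers $n \geq 0$ and $l \geq 0$, one has \[\sum_{i=0}^{l} \binom{n-i}{i}\binom{l+i}{2i+1}=\sum_{i=0}^{l} \binom{n-i}{i-1}\binom{l+i}{2i}.\]
   Context: Convention for binomial coefficients $\binom{m}{j}$ with $m, j \in \mathbb{Z}$: if $m \geq 0$, then $\binom{m}{j}$ is the usual binomial coefficient for $0 \leq j \leq m$, and $\binom{m}{j}=0$ if $j<0$ or $j>m$. If $m<0$, then $\binom{m}{j}:=(-1)^{j}\binom{j-m-1}{j}$ if $j \geq 0$, and $\binom{m}{j}:=0$ if $j<0$. Equivalently, $\binom{m}{j}=\frac{m(m-1)\cdots(m-j+1)}{j!}$ for $j \geq 0$ and $\binom{m}{j}=0$ for $j<0$. -}

module Defs where

open import Data.Fin.Base using (toℕ)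
open import Data.Integer.Base using (ℤ; +_; -[1+_]; 0ℤ; -1ℤ; _*_; _^_)
import Data.Integer.Properties as ℤ
import Data.Nat.Base as ℕ
open ℕ using (ℕ)
open import Data.Nat.Combinatorics using (_C_)
open import Algebra.Properties.CommutativeMonoid.Sum ℤ.+-0-commutativeMonoid
  using (sum⁺-syntax)

-- For a negative upper argument m = -(1 + k) we have j - m - 1 = j + k.
binom : ℤ → ℤ → ℤ
binom m        -[1+ j ] = 0ℤ
binom (+ m)    (+ j)    = + (m C j)
binom -[1+ k ] (+ j)    = -1ℤ ^ j * + ((j ℕ.+ k) C j)

infixl 10 ∑-syntax

-- Both bounds are inclusive; the index is an integer so that expressions
-- such as n - i and i - 1 are not truncated.
∑-syntax : ℕ → (ℤ → ℤ) → ℤ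
∑-syntax l f = sum⁺-syntax l (λ i → f (+ toℕ i))

syntax ∑-syntax l (λ i → e) = ∑[ 0≤ i ≤ l ] e

{-# OPTIONS --safe #-}

-- Extend n to all integers and write S(n,l), T(n,l) for the two sums and
-- U(n,l) = ∑ binom(n-i, i) binom(l+i, 2i).  Pascal's rule gives
--   S(n,l+1) = S(n,l) + U(n,l),
--   T(n,l+1) = T(n,l) + S(n-1,l+1),
--   U(n,l)   = U(n-1,l) + T(n-1,l).
-- If S(-,l) = T(-,l), then S(n-1,l+1) = T(n-1,l) + U(n-1,l) = U(n,l), so
-- T(n,l+1) = S(n,l) + U(n,l) = S(n,l+1); and S(-,0) = T(-,0) = 0.
module Submission where

open import Data.Fin.Base using (toℕ)
open import Data.Integer.Base using (ℤ; +_; -[1+_]; _+_; _-_; _*_; _^_; 0ℤ; -1ℤ)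
import Data.Integer.Properties as ℤ
open import Data.Integer.Tactic.RingSolver using (solve-∀)
open import Data.Nat.Base using (ℕ; zero; suc)
import Data.Nat.Base as ℕ
open import Data.Nat.Combinatorics using (_C_; nCn≡1; nCk+nC[k+1]≡[n+1]C[k+1])
open import Data.Nat.Combinatorics.Specification using (k>n⇒nCk≡0)
import Data.Nat.Properties as ℕ
open import Relation.Binary.PropositionalEquality
  using (_≡_; refl; sym; trans; cong; cong₂; module ≡-Reasoning)
open import Algebra.Properties.CommutativeMonoid.Sum ℤ.+-0-commutativeMonoid
  using (sum-cong-≗; ∑-distrib-+)
open import Defs

open ≡-Reasoning

∑-cong : ∀ l {f g : ℤ → ℤ} → (∀ i → f i ≡ g i) →
         ∑[ 0≤ i ≤ l ] f i ≡ ∑[ 0≤ i ≤ l ] g i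
∑-cong l f≗g = sum-cong-≗ {suc l} (λ i → f≗g (+ toℕ i))

∑-distrib : ∀ l (f g : ℤ → ℤ) →
            ∑[ 0≤ i ≤ l ] (f i + g i) ≡ ∑[ 0≤ i ≤ l ] f i + ∑[ 0≤ i ≤ l ] g i
∑-distrib l f g = ∑-distrib-+ {suc l} (λ i → f (+ toℕ i)) (λ i → g (+ toℕ i))

-- Sums unfold at their first term, so the last one is reached by induction on `l`, with the summand
-- shifted by one.
∑-last : ∀ l (f : ℤ → ℤ) →
         ∑[ 0≤ i ≤ suc l ] f i ≡ ∑[ 0≤ i ≤ l ] f i + f (+ suc l)
∑-last zero    f = lemma (f (+ 0)) (f (+ 1))
  where
  lemma : ∀ a b → a + (b + 0ℤ) ≡ (a + 0ℤ) + b
  lemma = solve-∀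
∑-last (suc l) f =
  trans (cong (_+_ (f (+ 0))) (∑-last l (λ i → f (+ 1 + i))))
        (sym (ℤ.+-assoc (f (+ 0)) _ _))

∑-last-zero : ∀ l (f : ℤ → ℤ) → f (+ suc l) ≡ 0ℤ →
              ∑[ 0≤ i ≤ suc l ] f i ≡ ∑[ 0≤ i ≤ l ] f i
∑-last-zero l f eq =
  trans (∑-last l f) (trans (cong (_+_ (∑[ 0≤ i ≤ l ] f i)) eq) (ℤ.+-identityʳ _))

-- Valid for all integers `m` and `j`, so the recurrences below need no side condition on the sign
-- of `n - i` or `i - 1`.
pascal : ∀ m j → binom (+ 1 + m) (+ 1 + j) ≡ binom m (+ 1 + j) + binom m j
pascal (+ m)         (+ j) = begin
  + (suc m C suc j)            ≡⟨ cong +_ (nCk+nC[k+1]≡[n+1]C[k+1] m j) ⟨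
  + (m C j) + + (m C suc j)    ≡⟨ ℤ.+-comm (+ (m C j)) (+ (m C suc j)) ⟩
  + (m C suc j) + + (m C j)    ∎
-- For `m = -1` the left side has upper argument 0 and vanishes; on the right, two consecutive
-- powers of -1 cancel.
pascal -[1+ zero ]   (+ j)
  rewrite ℕ.+-identityʳ j | nCn≡1 j | nCn≡1 (suc j) = lemma (-1ℤ ^ j)
  where
  lemma : ∀ s → 0ℤ ≡ -1ℤ * s * + 1 + s * + 1
  lemma = solve-∀
-- For `m = -(k + 2)` this is the natural-number rule in row `j + k + 1`, multiplied by alternating
-- signs.
pascal -[1+ suc k ]  (+ j)
  rewrite ℕ.+-suc j k | sym (nCk+nC[k+1]≡[n+1]C[k+1] (suc (j ℕ.+ k)) j) =
  lemma (-1ℤ ^ j) (+ (suc (j ℕ.+ k) C j)) (+ (suc (j ℕ.+ k) C suc j))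
  where
  lemma : ∀ s a b → -1ℤ * s * b ≡ -1ℤ * s * (a + b) + s * a
  lemma = solve-∀
-- For `j = -1` both sides are 1; the split on `m` only lets `1 + m` compute.
pascal (+ m)         -[1+ zero ]  = refl
pascal -[1+ zero ]   -[1+ zero ]  = refl
pascal -[1+ suc k ]  -[1+ zero ]  = refl
pascal m             -[1+ suc j ] = refl

pascal′ : ∀ m j {m′ j′} → m′ ≡ + 1 + m → j′ ≡ + 1 + j →
          binom m′ j′ ≡ binom m j′ + binom m j
pascal′ m j refl refl = pascal m j

binom-> : ∀ {m j} → m ℕ.< j → binom (+ m) (+ j) ≡ 0ℤ
binom-> m<j = cong +_ (k>n⇒nCk≡0 m<j)

sTerm tTerm uTerm : ℤ → ℕ → ℤ → ℤ
sTerm n l i = binom (n - i) i * binom (+ l + i) (+ 2 * i + + 1)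
tTerm n l i = binom (n - i) (i - + 1) * binom (+ l + i) (+ 2 * i)
uTerm n l i = binom (n - i) i * binom (+ l + i) (+ 2 * i)

S T U : ℤ → ℕ → ℤ
S n l = ∑[ 0≤ i ≤ l ] sTerm n l i
T n l = ∑[ 0≤ i ≤ l ] tTerm n l i
U n l = ∑[ 0≤ i ≤ l ] uTerm n l i

-- Pascal's rule on the second factor. The range stops at `l` because this is the sum left by the
-- index shift in `T-suc`; for `S-suc` the missing top term is zero.
∑-sTerm-suc : ∀ n l → ∑[ 0≤ i ≤ l ] sTerm n (suc l) i ≡ S n l + U n l
∑-sTerm-suc n l = trans (∑-cong l term) (∑-distrib l (sTerm n l) (uTerm n l))
  where
  upper : ∀ l i → (+ 1 + l) + i ≡ + 1 + (l + i)
  upper = solve-∀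
  lower : ∀ i → + 2 * i + + 1 ≡ + 1 + + 2 * i
  lower = solve-∀
  term : ∀ i → sTerm n (suc l) i ≡ sTerm n l i + uTerm n l i
  term i =
    trans (cong (binom (n - i) i *_)
                (pascal′ (+ l + i) (+ 2 * i) (upper (+ l) i) (lower i)))
          (ℤ.*-distribˡ-+ (binom (n - i) i)
             (binom (+ l + i) (+ 2 * i + + 1)) (binom (+ l + i) (+ 2 * i)))

S-suc : ∀ n l → S n (suc l) ≡ S n l + U n l
S-suc n l = trans (∑-last-zero l (sTerm n (suc l)) top) (∑-sTerm-suc n l)
  where
  top : sTerm n (suc l) (+ suc l) ≡ 0ℤ
  top = trans (cong (binom (n - + suc l) (+ suc l) *_) (binom-> L<2L+1))
              (ℤ.*-zeroʳ (binom (n - + suc l) (+ suc l)))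
    where
    -- At `i = l + 1` the lower argument exceeds the upper one by exactly 1.
    L<2L+1 : suc l ℕ.+ suc l ℕ.< 2 ℕ.* suc l ℕ.+ 1
    L<2L+1 = ℕ.≤-reflexive (trans (ℕ.+-comm 1 (suc l ℕ.+ suc l))
      (cong (λ k → suc l ℕ.+ k ℕ.+ 1) (sym (ℕ.+-identityʳ (suc l)))))

-- Pascal's rule on the second factor leaves a remainder with lower argument `2 * i - 1`. Replacing
-- `i` by `i + 1` turns it into the summand of `S (n - 1) (l + 1)`.
T-suc : ∀ n l → T n (suc l) ≡ T n l + (S (n - + 1) l + U (n - + 1) l)
T-suc n l = begin
  T n (suc l)
    ≡⟨ ∑-cong (suc l) term ⟩
  ∑[ 0≤ i ≤ suc l ] (tTerm n l i + rest i)
    ≡⟨ ∑-distrib (suc l) (tTerm n l) rest ⟩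
  ∑[ 0≤ i ≤ suc l ] tTerm n l i + ∑[ 0≤ i ≤ suc l ] rest i
    ≡⟨ cong₂ _+_ (∑-last-zero l (tTerm n l) top) shift ⟩
  T n l + ∑[ 0≤ i ≤ l ] sTerm (n - + 1) (suc l) i
    ≡⟨ cong (_+_ (T n l)) (∑-sTerm-suc (n - + 1) l) ⟩
  T n l + (S (n - + 1) l + U (n - + 1) l) ∎
  where
  rest : ℤ → ℤ
  rest i = binom (n - i) (i - + 1) * binom (+ l + i) (+ 2 * i - + 1)

  upper : ∀ l i → (+ 1 + l) + i ≡ + 1 + (l + i)
  upper = solve-∀
  lower : ∀ i → + 2 * i ≡ + 1 + (+ 2 * i - + 1)
  lower = solve-∀
  term : ∀ i → tTerm n (suc l) i ≡ tTerm n l i + rest i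
  term i =
    trans (cong (binom (n - i) (i - + 1) *_)
                (pascal′ (+ l + i) (+ 2 * i - + 1) (upper (+ l) i) (lower i)))
          (ℤ.*-distribˡ-+ (binom (n - i) (i - + 1))
             (binom (+ l + i) (+ 2 * i)) (binom (+ l + i) (+ 2 * i - + 1)))

  top : tTerm n l (+ suc l) ≡ 0ℤ
  top = trans (cong (binom (n - + suc l) (+ l) *_) (binom-> l+L<2L))
              (ℤ.*-zeroʳ (binom (n - + suc l) (+ l)))
    where
    l+L<2L : l ℕ.+ suc l ℕ.< 2 ℕ.* suc l
    l+L<2L = ℕ.≤-reflexive (cong (suc l ℕ.+_) (sym (ℕ.+-identityʳ (suc l))))

  upper₁ : ∀ n i → n - (+ 1 + i) ≡ (n - + 1) - i
  upper₁ = solve-∀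
  lower₁ : ∀ i → (+ 1 + i) - + 1 ≡ i
  lower₁ = solve-∀
  upper₂ : ∀ l i → l + (+ 1 + i) ≡ (+ 1 + l) + i
  upper₂ = solve-∀
  lower₂ : ∀ i → + 2 * (+ 1 + i) - + 1 ≡ + 2 * i + + 1
  lower₂ = solve-∀
  rest-suc : ∀ i → rest (+ 1 + i) ≡ sTerm (n - + 1) (suc l) i
  rest-suc i = cong₂ _*_ (cong₂ binom (upper₁ n i) (lower₁ i))
                         (cong₂ binom (upper₂ (+ l) i) (lower₂ i))

  shift : ∑[ 0≤ i ≤ suc l ] rest i ≡ ∑[ 0≤ i ≤ l ] sTerm (n - + 1) (suc l) i
  shift = begin
    rest 0ℤ + ∑[ 0≤ i ≤ l ] rest (+ 1 + i)
      -- The term at `i = 0` vanishes because its lower arguments are -1.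
      ≡⟨ cong₂ _+_ (ℤ.*-zeroʳ (binom (n - 0ℤ) -1ℤ)) (∑-cong l rest-suc) ⟩
    0ℤ + ∑[ 0≤ i ≤ l ] sTerm (n - + 1) (suc l) i
      ≡⟨ ℤ.+-identityˡ _ ⟩
    ∑[ 0≤ i ≤ l ] sTerm (n - + 1) (suc l) i ∎

-- Here Pascal's rule acts on the first factor, whose upper argument drops to `n - 1 - i`.
U-pred : ∀ n l → U n l ≡ U (n - + 1) l + T (n - + 1) l
U-pred n l =
  trans (∑-cong l term) (∑-distrib l (uTerm (n - + 1) l) (tTerm (n - + 1) l))
  where
  upper : ∀ n i → n - i ≡ + 1 + ((n - + 1) - i)
  upper = solve-∀
  lower : ∀ i → i ≡ + 1 + (i - + 1)
  lower = solve-∀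
  term : ∀ i → uTerm n l i ≡ uTerm (n - + 1) l i + tTerm (n - + 1) l i
  term i =
    trans (cong (_* binom (+ l + i) (+ 2 * i))
                (pascal′ ((n - + 1) - i) (i - + 1) (upper n i) (lower i)))
          (ℤ.*-distribʳ-+ (binom (+ l + i) (+ 2 * i))
             (binom ((n - + 1) - i) i) (binom ((n - + 1) - i) (i - + 1)))

-- Induction on `l` for all integers `n` at once: the step uses the hypothesis at both `n` and
-- `n - 1`, and the latter may be negative.
S≡T : ∀ l n → S n l ≡ T n l
-- The only term of `S` contains `binom 0 1 = 0`; that of `T` has lower argument -1 and computes to
-- 0.
S≡T zero    n = cong (_+ 0ℤ) (ℤ.*-zeroʳ (binom (n - 0ℤ) 0ℤ))
S≡T (suc l) n = begin
  S n (suc l)                                ≡⟨ S-suc n l ⟩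
  S n l + U n l                              ≡⟨ cong₂ _+_ (S≡T l n) (U-pred n l) ⟩
  T n l + (U (n - + 1) l + T (n - + 1) l)    ≡⟨ cong (_+_ (T n l)) (ℤ.+-comm (U (n - + 1) l) _) ⟩
  T n l + (T (n - + 1) l + U (n - + 1) l)    ≡⟨ cong (λ t → T n l + (t + U (n - + 1) l)) (S≡T l (n - + 1)) ⟨
  T n l + (S (n - + 1) l + U (n - + 1) l)    ≡⟨ T-suc n l ⟨
  T n (suc l)                                ∎

mainTheorem2 : (n l : ℕ) →
    ∑[ 0≤ i ≤ l ] (binom (+ n - i) i * binom (+ l + i) (+ 2 * i + + 1))
    ≡ ∑[ 0≤ i ≤ l ] (binom (+ n - i) (i - + 1) * binom (+ l + i) (+ 2 * i))
mainTheorem2 n l = S≡T l (+ n)
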